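{- Let $G=(V,E)$ be a graph without isolated vertices of order $n\geq 2$ and let $t\geq 2$. Then $\lambda(M^t(G))=2^{t-1}(n+2)-2$ if and only if for every $S\subseteq V$ we have $|D_2(S)|\geq |S|$, where $D_2(S)=\{x\in V : \exists v\in S,\ d_G(x,v)>2\}$.
   Context: Graphs are finite, simple, undirected; $d_G(x,v)$ is the distance in $G$ (infinite if $x,v$ lie in different components). An $L(2,1)$-labeling of $G$ is a map $f:V\to\{0,1,2,\dots\}$ with $|f(x)-f(y)|\ge 2$ if $d_G(x,y)=1$ and $|f(x)-f(y)|\ge1$ if $d_G(x,y)=2$; $\lambda(G)$ is the minimum over such $f$ of the largest label. For $V=\{v_1,\dots,v_n\}$, $M(G)$ has vertex set $V\cup\{v_1',\dots,v_n'\}\cup\{u\}$ and edge set $E\cup\{v_iv_j' : v_iv_j\in E\}\cup\{v_i'u: 1\le i\le n\}$; $M^0(G)=G$, $M^t(G)=M(M^{t-1}(G))$. -}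

module Defs where

open import Data.Bool using (Bool; true; false; _∧_; _∨_; not; if_then_else_)
open import Data.Nat using (ℕ; zero; suc; _≤_; _<_; ∣_-_∣)
open import Data.Fin using (Fin; _≟_)
open import Data.Fin.Subset using (Subset)
open import Data.List using (allFin)
open import Data.Bool.ListAction using (any)
open import Data.Vec using (tabulate; lookup)
open import Data.Product using (Σ; ∃; _×_; _,_)
open import Relation.Nullary using (¬_; does)
open import Relation.Binary.PropositionalEquality using (_≡_; _≢_; refl)

record Graph (V : Set) : Set where
  field
    adj    : V → V → Bool
    sym    : ∀ x y → adj x y ≡ adj y x
    irrefl : ∀ x → adj x x ≡ false
open Graph public

data Walk {V : Set} (G : Graph V) : V → V → ℕ → Set where
  here : ∀ {x} → Walk G x x zero
  step : ∀ {x y z k} → adj G x y ≡ true → Walk G y z k → Walk G x z (suc k)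

Dist : {V : Set} → Graph V → V → V → ℕ → Set
Dist G x y k = Walk G x y k × (∀ j → j < k → ¬ Walk G x y j)

IsL21 : {V : Set} → Graph V → (V → ℕ) → Set
IsL21 G f = ∀ x y →
  (Dist G x y 1 → 2 ≤ ∣ f x - f y ∣) × (Dist G x y 2 → f x ≢ f y)

IsLambda : {V : Set} → Graph V → ℕ → Set
IsLambda G k =
  (Σ (_ → ℕ) λ f → IsL21 G f × (∀ x → f x ≤ k)) ×
  (∀ f → IsL21 G f → ∃ λ x → k ≤ f x)

-- Vertices of the Mycielskian: old copies v_i, new copies v_i', hub u.
data MV (V : Set) : Set where
  old : V → MV V
  new : V → MV V
  hub : MV V

madj : {V : Set} → Graph V → MV V → MV V → Bool
madj G (old i) (old j) = adj G i j
madj G (old i) (new j) = adj G i j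
madj G (old i) hub     = false
madj G (new i) (old j) = adj G i j
madj G (new i) (new j) = false
madj G (new i) hub     = true
madj G hub     (old j) = false
madj G hub     (new j) = true
madj G hub     hub     = false

msym : {V : Set} (G : Graph V) → ∀ x y → madj G x y ≡ madj G y x
msym G (old i) (old j) = sym G i j
msym G (old i) (new j) = sym G i j
msym G (old i) hub     = refl
msym G (new i) (old j) = sym G i j
msym G (new i) (new j) = refl
msym G (new i) hub     = refl
msym G hub     (old j) = refl
msym G hub     (new j) = refl
msym G hub     hub     = refl

mirrefl : {V : Set} (G : Graph V) → ∀ x → madj G x x ≡ false
mirrefl G (old i) = irrefl G i
mirrefl G (new i) = refl
mirrefl G hub     = refl

M : {V : Set} → Graph V → Graph (MV V)
M G = record { adj = madj G ; sym = msym G ; irrefl = mirrefl G }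

MVⁿ : ℕ → Set → Set
MVⁿ zero    V = V
MVⁿ (suc t) V = MV (MVⁿ t V)

Mᵗ : {V : Set} → (t : ℕ) → Graph V → Graph (MVⁿ t V)
Mᵗ zero    G = G
Mᵗ (suc t) G = M (Mᵗ t G)

NoIsolated : {V : Set} → Graph V → Set
NoIsolated G = ∀ x → ∃ λ y → adj G x y ≡ true

within2 : {n : ℕ} → Graph (Fin n) → Fin n → Fin n → Bool
within2 {n} G x v =
  does (x ≟ v) ∨ adj G x v ∨ any (λ w → adj G x w ∧ adj G w v) (allFin n)

D₂ : {n : ℕ} → Graph (Fin n) → Subset n → Subset n
D₂ {n} G S =
  tabulate λ x → any (λ v → lookup S v ∧ not (within2 G x v)) (allFin n)

{-# OPTIONS --safe #-}
-- Vertices of Mᵗ(G) are either hubs (copies of some u) or pairs (v , w) of a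
-- vertex of G and a word recording the levels at which v is replaced by its new
-- copy. Hubs are within distance 2 of everything, and (v , w), (v′ , w′) are at
-- distance > 2 iff v, v′ are and w, w′ are disjoint. So all hubs together with all
-- outermost new copies need distinct labels; there are 2^(t-1)(n+2) - 1 of them.
--
-- If that bound is attained, then each (v , all inner levels) shares its label with
-- some (v′ , outermost level) where d(v , v′) > 2, and v ↦ v′ is injective.
--
-- Conversely, Hall's theorem gives an injection along pairs at distance > 2. Its
-- cycles of even length split into edges, so V is partitioned into edges and odd
-- cycles of the graph "distance > 2". For consecutive a, b on such an edge or cycle,
-- (a , w) and (b , complement of w) share a label. The label classes are arranged in
-- a sequence without edges between consecutive classes: first the hubs, then block
-- by block. A vertex adjacent to a is not adjacent to b, hence a new block can always
-- be entered; for an odd cycle this is a parity argument.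
module Submission where

open import Defs
open import Data.Nat as ℕ using (ℕ; zero; suc; _≤_; _<_; _*_; _+_; _∸_; _^_; ∣_-_∣; z≤n; s≤s; s≤s⁻¹; z<s; _≤?_; _<?_)
open import Data.Fin as Fin using (Fin; zero; suc; toℕ; fromℕ<; _≟_)
open import Data.Fin.Subset using (Subset; ∣_∣; _⊆_; _∪_; _∩_; ⁅_⁆; ∁) renaming (_∈_ to _∈ˢ_; _∉_ to _∉ˢ_; _-_ to _∖_)
open import Function.Bundles using (_⇔_; mk⇔)
open import Data.Bool as Bool using (Bool; true; false; _∧_; not; if_then_else_)
open import Data.Bool.ListAction using (any)
open import Data.Bool.Properties using (not-involutive; ¬-not)
open import Data.Fin.Properties using (suc-injective; toℕ<n; fromℕ<-injective)
open import Data.Fin.Subset.Properties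
open import Data.List using (List; []; _∷_; [_]; _++_; length; map; concatMap; filter; allFin; cartesianProduct)
open import Data.List.Membership.DecPropositional ℕ._≟_ using () renaming (_∈?_ to _∈ℕ?_)
open import Data.List.Membership.Propositional using (_∈_; _∉_; find; lose)
open import Data.List.Membership.Propositional.Properties using (∈-map⁺; ∈-map⁻; ∈-++⁺ˡ; ∈-++⁺ʳ; ∈-++⁻; ∈-∃++; ∈-allFin; ∈-cartesianProduct⁺; ∈-filter⁺; ∈-filter⁻)
open import Data.List.Properties using (length-map; length-++; length-tabulate; filter-notAll; ++-identityʳ; concatMap-++)
open import Data.List.Relation.Unary.All as All using (All; []; _∷_)
import Data.List.Relation.Unary.All.Properties as Allₚ
open import Data.List.Relation.Unary.AllPairs using ([]; _∷_)
open import Data.List.Relation.Unary.Any as Any using (Any; here; there; index)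
open import Data.List.Relation.Unary.Unique.Propositional using (Unique)
open import Data.List.Relation.Unary.Unique.Propositional.Properties using (allFin⁺) renaming (map⁺ to Unique-map⁺; ++⁺ to Unique-++⁺)
open import Data.Nat.Properties using (≤-refl; ≤-trans; ≤-reflexive; ≮⇒≥; 1+n≰n; m≤m+n; m≤n+m; m≤n*m; m^n≢0; ∣n-n∣≡0; +-suc; +-comm; +-identityʳ; +-mono-≤; +-monoˡ-≤; +-monoʳ-≤; *-assoc; *-distribʳ-+; *-monoʳ-≤; ∸-monoˡ-≤; module ≤-Reasoning) renaming (suc-injective to ℕ-suc-injective)
open import Data.Nat.Tactic.RingSolver using (solve-∀)
open import Data.Product using (Σ; ∃; ∃₂; _×_; _,_; proj₁; proj₂; map₂)
open import Data.Sum using (_⊎_; inj₁; inj₂; [_,_]′)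
open import Data.Unit using (⊤; tt)
open import Data.Vec using (Vec; []; _∷_; here; there; lookup; tabulate; replicate)
open import Data.Vec.Properties using ([]=⇒lookup; lookup⇒[]=; lookup∘tabulate)
open import Function using (_∘_)
open import Relation.Binary.PropositionalEquality using (_≡_; _≢_; refl; trans; cong; cong₂; subst; module ≡-Reasoning) renaming (sym to ≡-sym)
open import Relation.Nullary using (¬_; ¬?; yes; no; does; contradiction)

-- Boolean search and cardinalities of finite subsets

∧-true⁻ : ∀ a {b} → a ∧ b ≡ true → a ≡ true × b ≡ true
∧-true⁻ true b≡true = refl , b≡true

any-true⁻ : ∀ {A : Set} (p : A → Bool) xs → any p xs ≡ true → ∃ λ x → p x ≡ true
any-true⁻ p (x ∷ xs) eq with p x in px
... | true  = x , px
... | false = any-true⁻ p xs eq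

any-true⁺ : ∀ {A : Set} (p : A → Bool) {x xs} → x ∈ xs → p x ≡ true → any p xs ≡ true
any-true⁺ p (here refl) px rewrite px = refl
any-true⁺ p {xs = y ∷ _} (there x∈xs) px with p y
... | true  = refl
... | false = any-true⁺ p x∈xs px

length≤∣p∣ : ∀ {n} {l : List (Fin n)} {p : Subset n} → Unique l → All (_∈ˢ p) l → length l ≤ ∣ p ∣
length≤∣p∣ [] [] = z≤n
length≤∣p∣ (x≢ ∷ l!) (x∈p ∷ l⊆p) = ≤-trans
  (s≤s (length≤∣p∣ l! (All.zipWith (λ (x≢y , y∈p) → x∈p∧x≢y⇒x∈p-y y∈p (x≢y ∘ ≡-sym)) (x≢ , l⊆p))))
  (x∈p⇒∣p-x∣<∣p∣ x∈p)

elements : ∀ {n} (p : Subset n) → ∃ λ l → Unique l × All (_∈ˢ p) l × length l ≡ ∣ p ∣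
elements [] = [] , [] , [] , refl
elements (b ∷ p) with elements p
... | l , l! , l⊆p , len = go b
  where
  l′! = Unique-map⁺ suc-injective l!
  l′⊆ : ∀ {b} → All (_∈ˢ (b ∷ p)) (map suc l)
  l′⊆ = Allₚ.map⁺ (All.map there l⊆p)
  go : ∀ b → ∃ λ l → Unique l × All (_∈ˢ (b ∷ p)) l × length l ≡ ∣ b ∷ p ∣
  go true  = zero ∷ map suc l , Allₚ.map⁺ (All.tabulate λ _ ()) ∷ l′! , here ∷ l′⊆ ,
             cong suc (trans (length-map suc l) len)
  go false = map suc l , l′! , l′⊆ , trans (length-map suc l) len

injection⇒∣p∣≤∣q∣ : ∀ {n} {p q : Subset n} (g : Fin n → Fin n) → (∀ {x y} → g x ≡ g y → x ≡ y) →
                    (∀ {x} → x ∈ˢ p → g x ∈ˢ q) → ∣ p ∣ ≤ ∣ q ∣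
injection⇒∣p∣≤∣q∣ {p = p} g inj g∈ with elements p
... | l , l! , l⊆p , len = subst (_≤ _) (trans (length-map g l) len)
        (length≤∣p∣ (Unique-map⁺ inj l!) (Allₚ.map⁺ (All.map g∈ l⊆p)))

∣p∪q∣+∣p∩q∣≡∣p∣+∣q∣ : ∀ {n} (p q : Subset n) → ∣ p ∪ q ∣ + ∣ p ∩ q ∣ ≡ ∣ p ∣ + ∣ q ∣
∣p∪q∣+∣p∩q∣≡∣p∣+∣q∣ [] [] = refl
∣p∪q∣+∣p∩q∣≡∣p∣+∣q∣ (true ∷ p) (true ∷ q) = cong suc (trans (+-suc _ _)
  (trans (cong suc (∣p∪q∣+∣p∩q∣≡∣p∣+∣q∣ p q)) (≡-sym (+-suc _ _))))
∣p∪q∣+∣p∩q∣≡∣p∣+∣q∣ (true ∷ p) (false ∷ q) = cong suc (∣p∪q∣+∣p∩q∣≡∣p∣+∣q∣ p q)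
∣p∪q∣+∣p∩q∣≡∣p∣+∣q∣ (false ∷ p) (true ∷ q) = trans (cong suc (∣p∪q∣+∣p∩q∣≡∣p∣+∣q∣ p q)) (≡-sym (+-suc _ _))
∣p∪q∣+∣p∩q∣≡∣p∣+∣q∣ (false ∷ p) (false ∷ q) = ∣p∪q∣+∣p∩q∣≡∣p∣+∣q∣ p q

x∉p-x : ∀ {n} (p : Subset n) {x} → x ∉ˢ p ∖ x
x∉p-x (_ ∷ p) {zero}  ()
x∉p-x (_ ∷ p) {suc i} (there x∈) = x∉p-x p x∈

∣p∣≤1+∣p-x∣ : ∀ {n} (p : Subset n) x → ∣ p ∣ ≤ suc ∣ p ∖ x ∣
∣p∣≤1+∣p-x∣ p x = ≤-trans (p⊆q⇒∣p∣≤∣q∣ p⊆) (≤-trans (≤-trans (m≤m+n _ _)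
    (≤-reflexive (∣p∪q∣+∣p∩q∣≡∣p∣+∣q∣ ⁅ x ⁆ (p ∖ x)))) (≤-reflexive (cong (_+ ∣ p ∖ x ∣) (∣⁅x⁆∣≡1 x))))
  where
  p⊆ : p ⊆ ⁅ x ⁆ ∪ (p ∖ x)
  p⊆ {y} y∈p with y ≟ x
  ... | yes refl = x∈p∪q⁺ (inj₁ (x∈⁅x⁆ x))
  ... | no  y≢x  = x∈p∪q⁺ (inj₂ (x∈p∧x≢y⇒x∈p-y y∈p y≢x))

-- Hall's theorem

module _ {n : ℕ} where

  Rel : Set
  Rel = Fin n → Fin n → Bool

  nbhd : Rel → Subset n → Subset n
  nbhd R S = tabulate λ y → any (λ x → lookup S x ∧ R x y) (allFin n)

  ∈-nbhd⁺ : ∀ R {S x y} → x ∈ˢ S → R x y ≡ true → y ∈ˢ nbhd R S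
  ∈-nbhd⁺ R {S} {x} {y} x∈S Rxy = lookup⇒[]= y _ (trans (lookup∘tabulate _ y)
    (any-true⁺ _ (∈-allFin x) (cong₂ _∧_ ([]=⇒lookup x∈S) Rxy)))

  ∈-nbhd⁻ : ∀ R {S y} → y ∈ˢ nbhd R S → ∃ λ x → x ∈ˢ S × R x y ≡ true
  ∈-nbhd⁻ R {S} {y} y∈
    with x , eq ← any-true⁻ _ (allFin n) (trans (≡-sym (lookup∘tabulate _ y)) ([]=⇒lookup y∈))
    with S∋x , Rxy ← ∧-true⁻ (lookup S x) eq = x , lookup⇒[]= x S S∋x , Rxy

  nbhd-⊆ : ∀ R R′ {S} → (∀ {x y} → x ∈ˢ S → R x y ≡ true → R′ x y ≡ true) → nbhd R S ⊆ nbhd R′ S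
  nbhd-⊆ R R′ sub y∈ with x , x∈S , Rxy ← ∈-nbhd⁻ R y∈ = ∈-nbhd⁺ R′ x∈S (sub x∈S Rxy)

  Hall : Rel → Set
  Hall R = ∀ S → ∣ S ∣ ≤ ∣ nbhd R S ∣

  Deficient : Rel → Set
  Deficient R = ∃ λ S → ∣ nbhd R S ∣ < ∣ S ∣

  Hall-or-Deficient : ∀ R → Hall R ⊎ Deficient R
  Hall-or-Deficient R with anySubset? (λ S → ∣ nbhd R S ∣ <? ∣ S ∣)
  ... | yes d = inj₂ d
  ... | no ¬d = inj₁ λ S → ≮⇒≥ λ lt → ¬d (S , lt)

  _⊑_ : Rel → Rel → Set
  R ⊑ R′ = ∀ {x y} → R x y ≡ true → R′ x y ≡ true

  Deficient-mono : ∀ {R R′} → R ⊑ R′ → Deficient R′ → Deficient R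
  Deficient-mono {R} {R′} R⊑R′ (S , lt) = S , ≤-trans (s≤s (p⊆q⇒∣p∣≤∣q∣ (nbhd-⊆ R R′ {S} λ _ → R⊑R′))) lt

  delete : Fin n × Fin n → Rel → Rel
  delete (a , b) R x y = if does (x ≟ a) ∧ does (y ≟ b) then false else R x y

  delete⁻ : ∀ {e R x y} → delete e R x y ≡ true → R x y ≡ true × (x , y) ≢ e
  delete⁻ {a , b} {R} {x} {y} eq with x ≟ a | y ≟ b
  ... | yes _  | no y≢b = eq , λ { refl → y≢b refl }
  ... | no x≢a | _      = eq , λ { refl → x≢a refl }

  delete⁺ : ∀ {e R x y} → R x y ≡ true → (x , y) ≢ e → delete e R x y ≡ true
  delete⁺ {a , b} {R} {x} {y} Rxy ne with x ≟ a | y ≟ b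
  ... | yes refl | yes refl = contradiction refl ne
  ... | yes _    | no _     = Rxy
  ... | no _     | _        = Rxy

  -- Deletes each listed edge whose loss preserves `Hall`. An edge that had to be kept is still
  -- indispensable at the end, since later deletions only shrink the relation and `Deficient`
  -- survives that.
  minimise : ∀ es R → Hall R → ∃ λ R′ → R′ ⊑ R × Hall R′ ×
             All (λ (x , y) → R′ x y ≡ true → Deficient (delete (x , y) R′)) es
  minimise [] R hall = R , (λ Rxy → Rxy) , hall , []
  minimise (e ∷ es) R hall with Hall-or-Deficient (delete e R)
  ... | inj₁ hall₁ with R′ , R′⊑ , hall′ , ess ← minimise es (delete e R) hall₁ =
        R′ , (λ R′xy → proj₁ (delete⁻ {e} {R} (R′⊑ R′xy))) , hall′ ,
        (λ R′e → contradiction refl (proj₂ (delete⁻ {e} {R} (R′⊑ R′e)))) ∷ ess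
  ... | inj₂ def with R′ , R′⊑ , hall′ , ess ← minimise es R hall =
        R′ , R′⊑ , hall′ ,
        (λ _ → Deficient-mono (λ d → let R′xy , ne = delete⁻ {e} {R′} d in delete⁺ {e} {R} (R′⊑ R′xy) ne) def) ∷ ess

  -- If `x ∉ S`, deleting an edge that starts at `x` leaves the neighbourhood of `S` as it was, and
  -- `S` would violate `hall`.
  deficient-∋ : ∀ {R x y} → Hall R → (d : Deficient (delete (x , y) R)) → x ∈ˢ proj₁ d
  deficient-∋ {R} {x} {y} hall (S , lt) with x ∈? S
  ... | yes x∈S = x∈S
  ... | no  x∉S = contradiction (≤-trans lt (≤-trans (hall S) (p⊆q⇒∣p∣≤∣q∣
        (nbhd-⊆ R (delete (x , y) R) λ w∈S Rwz → delete⁺ {x , y} {R} Rwz λ { refl → x∉S w∈S })))) 1+n≰n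

  -- Submodularity of S ↦ ∣ nbhd R S ∣, applied to two sets through x, each
  -- deficient once one of the two edges at x is deleted.
  minimal⇒functional : ∀ {R x y₁ y₂} → Hall R →
    Deficient (delete (x , y₁) R) → Deficient (delete (x , y₂) R) → y₁ ≡ y₂
  minimal⇒functional {R} {x} {y₁} {y₂} hall d₁@(S₁ , lt₁) d₂@(S₂ , lt₂) with y₁ ≟ y₂
  ... | yes eq = eq
  ... | no  ne = contradiction chain 1+n≰n
    where
    R₁ = delete (x , y₁) R
    R₂ = delete (x , y₂) R
    N₁ = nbhd R₁ S₁
    N₂ = nbhd R₂ S₂
    -- Both deleted edges start at `x`, so edges leaving `I` survive in `R₁` and `R₂`. Dropping `x`
    -- costs one in the count, while `lt₁` and `lt₂` together gain two.
    I  = S₁ ∩ S₂ ∖ x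

    in₁ : ∀ {w z} → w ∈ˢ S₁ → R w z ≡ true → (w , z) ≢ (x , y₁) → z ∈ˢ N₁
    in₁ w∈ Rwz p = ∈-nbhd⁺ R₁ w∈ (delete⁺ {x , y₁} {R} Rwz p)

    in₂ : ∀ {w z} → w ∈ˢ S₂ → R w z ≡ true → (w , z) ≢ (x , y₂) → z ∈ˢ N₂
    in₂ w∈ Rwz p = ∈-nbhd⁺ R₂ w∈ (delete⁺ {x , y₂} {R} Rwz p)

    -- As `y₁ ≢ y₂`, the edge missing from one relation is present in the other.
    at-x : ∀ {z} → R x z ≡ true → z ∈ˢ N₁ ∪ N₂
    at-x {z} Rxz with z ≟ y₁
    ... | yes refl = x∈p∪q⁺ (inj₂ (in₂ (deficient-∋ {R} hall d₂) Rxz λ { refl → ne refl }))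
    ... | no  z≢   = x∈p∪q⁺ (inj₁ (in₁ (deficient-∋ {R} hall d₁) Rxz λ { refl → z≢ refl }))

    union : nbhd R (S₁ ∪ S₂) ⊆ N₁ ∪ N₂
    union z∈ with w , w∈ , Rwz ← ∈-nbhd⁻ R z∈ with w ≟ x
    ... | yes refl = at-x Rwz
    ... | no  w≢x with x∈p∪q⁻ S₁ S₂ w∈
    ...   | inj₁ w∈₁ = x∈p∪q⁺ (inj₁ (in₁ w∈₁ Rwz λ { refl → w≢x refl }))
    ...   | inj₂ w∈₂ = x∈p∪q⁺ (inj₂ (in₂ w∈₂ Rwz λ { refl → w≢x refl }))

    inter : nbhd R I ⊆ N₁ ∩ N₂
    inter z∈ with w , w∈ , Rwz ← ∈-nbhd⁻ R z∈
      with w∈₁ , w∈₂ ← x∈p∩q⁻ S₁ S₂ (p─q⊆p (S₁ ∩ S₂) ⁅ x ⁆ w∈) =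
      x∈p∩q⁺ (in₁ w∈₁ Rwz (λ { refl → x∉p-x (S₁ ∩ S₂) w∈ }) , in₂ w∈₂ Rwz λ { refl → x∉p-x (S₁ ∩ S₂) w∈ })

    chain : suc (∣ S₁ ∣ + ∣ S₂ ∣) ≤ ∣ S₁ ∣ + ∣ S₂ ∣
    chain = begin
      suc (∣ S₁ ∣ + ∣ S₂ ∣)                     ≡⟨ cong suc (≡-sym (∣p∪q∣+∣p∩q∣≡∣p∣+∣q∣ S₁ S₂)) ⟩
      suc (∣ S₁ ∪ S₂ ∣ + ∣ S₁ ∩ S₂ ∣)           ≤⟨ s≤s (+-monoʳ-≤ _ (∣p∣≤1+∣p-x∣ (S₁ ∩ S₂) x)) ⟩
      suc (∣ S₁ ∪ S₂ ∣ + suc ∣ I ∣)             ≡⟨ cong suc (+-suc _ _) ⟩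
      suc (suc (∣ S₁ ∪ S₂ ∣ + ∣ I ∣))           ≤⟨ s≤s (s≤s (+-mono-≤ (≤-trans (hall (S₁ ∪ S₂)) (p⊆q⇒∣p∣≤∣q∣ union))
                                                                     (≤-trans (hall I) (p⊆q⇒∣p∣≤∣q∣ inter)))) ⟩
      suc (suc (∣ N₁ ∪ N₂ ∣ + ∣ N₁ ∩ N₂ ∣))     ≡⟨ cong (2 +_) (∣p∪q∣+∣p∩q∣≡∣p∣+∣q∣ N₁ N₂) ⟩
      suc (suc (∣ N₁ ∣ + ∣ N₂ ∣))               ≡⟨ cong suc (≡-sym (+-suc _ _)) ⟩
      suc ∣ N₁ ∣ + suc ∣ N₂ ∣                   ≤⟨ +-mono-≤ lt₁ lt₂ ⟩
      ∣ S₁ ∣ + ∣ S₂ ∣                           ∎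
      where open ≤-Reasoning

  -- A minimal Hall relation is already the graph of an injection: it is functional, Hall's
  -- condition for singletons gives every `x` a neighbour, and a pair with a common image would
  -- violate the condition.
  hall-theorem : ∀ R → Hall R → ∃ λ (π : Fin n → Fin n) →
                 (∀ {x y} → π x ≡ π y → x ≡ y) × (∀ x → R x (π x) ≡ true)
  hall-theorem R hall
    with R′ , R′⊑R , hall′ , ess ← minimise (cartesianProduct (allFin n) (allFin n)) R hall
    = (λ x → proj₁ (pick x)) , injective , (λ x → R′⊑R (proj₂ (pick x)))
    where
    functional : ∀ {x y z} → R′ x y ≡ true → R′ x z ≡ true → y ≡ z
    functional {x} {y} {z} Rxy Rxz = minimal⇒functional {R′} hall′
      (All.lookup ess (∈-cartesianProduct⁺ (∈-allFin x) (∈-allFin y)) Rxy)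
      (All.lookup ess (∈-cartesianProduct⁺ (∈-allFin x) (∈-allFin z)) Rxz)

    pick : ∀ x → ∃ λ y → R′ x y ≡ true
    pick x with nonempty? (nbhd R′ ⁅ x ⁆)
    ... | yes (y , y∈) with w , w∈ , Rwy ← ∈-nbhd⁻ R′ y∈ rewrite x∈⁅y⁆⇒x≡y x w∈ = y , Rwy
    ... | no  ¬ne = contradiction (≤-trans (≤-trans (≤-reflexive (≡-sym (∣⁅x⁆∣≡1 x))) (hall′ ⁅ x ⁆))
                      (≤-reflexive (trans (cong ∣_∣ (Empty-unique ¬ne)) (∣⊥∣≡0 n)))) λ ()

    injective : ∀ {x₁ x₂} → proj₁ (pick x₁) ≡ proj₁ (pick x₂) → x₁ ≡ x₂
    injective {x₁} {x₂} eq with x₁ ≟ x₂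
    ... | yes same = same
    ... | no  diff = contradiction (≤-trans (≤-trans
            (length≤∣p∣ {l = x₁ ∷ x₂ ∷ []} ((diff ∷ []) ∷ [] ∷ [])
              (x∈p∪q⁺ (inj₁ (x∈⁅x⁆ x₁)) ∷ x∈p∪q⁺ (inj₂ (x∈⁅x⁆ x₂)) ∷ []))
            (≤-trans (hall′ (⁅ x₁ ⁆ ∪ ⁅ x₂ ⁆)) (p⊆q⇒∣p∣≤∣q∣ single))) (≤-reflexive (∣⁅x⁆∣≡1 y))) 1+n≰n
      where
      y = proj₁ (pick x₁)
      single : nbhd R′ (⁅ x₁ ⁆ ∪ ⁅ x₂ ⁆) ⊆ ⁅ y ⁆
      single {z} z∈ with w , w∈ , Rwz ← ∈-nbhd⁻ R′ z∈ with x∈p∪q⁻ ⁅ x₁ ⁆ ⁅ x₂ ⁆ w∈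
      ... | inj₁ w∈₁ rewrite x∈⁅y⁆⇒x≡y x₁ w∈₁ | functional Rwz (proj₂ (pick x₁)) = x∈⁅x⁆ y
      ... | inj₂ w∈₂ rewrite x∈⁅y⁆⇒x≡y x₂ w∈₂ | functional Rwz (proj₂ (pick x₂)) | eq = x∈⁅x⁆ _

-- L(2,1)-labellings

-- For distinct vertices this is distance 1 or 2, without mention of shortest walks; `Near G x x`
-- holds as soon as `x` has a neighbour.
Near : ∀ {V} → Graph V → V → V → Set
Near G x y = adj G x y ≡ true ⊎ ∃ λ c → adj G x c ≡ true × adj G c y ≡ true

adj-sym : ∀ {V} (G : Graph V) {x y b} → adj G x y ≡ b → adj G y x ≡ b
adj-sym G {x} {y} xy = trans (Graph.sym G y x) xy

Near-sym : ∀ {V} (G : Graph V) {x y} → Near G x y → Near G y x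
Near-sym G (inj₁ xy)            = inj₁ (adj-sym G xy)
Near-sym G (inj₂ (c , xc , cy)) = inj₂ (c , adj-sym G cy , adj-sym G xc)

Far : ∀ {V} → Graph V → V → V → Set
Far G x y = x ≢ y × ¬ Near G x y

Far-sym : ∀ {V} (G : Graph V) {x y} → Far G x y → Far G y x
Far-sym G (x≢y , ¬near) = (λ y≡x → x≢y (≡-sym y≡x)) , ¬near ∘ Near-sym G

true≢false : ∀ {b} → b ≡ true → b ≡ false → ∀ {A : Set} → A
true≢false refl ()

module _ {V : Set} (G : Graph V) where

  L21⇒≢ : ∀ {f x y} → IsL21 G f → Near G x y → x ≢ y → f x ≢ f y
  L21⇒≢ {f} {x} {y} L21 near x≢y fx≡fy with adj G x y in xy
  ... | true = contradiction (subst (2 ≤_) (trans (cong ∣_- f y ∣ fx≡fy) (∣n-n∣≡0 (f y)))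
                 (proj₁ (L21 x y) (step xy here , λ { zero _ here → x≢y refl ; (suc _) (s≤s ()) }))) λ ()
  ... | false with near
  ...   | inj₂ (c , xc , cy) = proj₂ (L21 x y) (step xc (step cy here) , λ where
            zero          _ here           → x≢y refl
            (suc zero)    _ (step e here)  → true≢false e xy
            (suc (suc _)) (s≤s (s≤s ()))) fx≡fy

-- Seg R x xs y excludes the first element x from xs, so that segments concatenate.
data Seg {A : Set} (R : A → A → Set) : A → List A → A → Set where
  end : ∀ {x} → Seg R x [] x
  _◂_ : ∀ {x y z xs} → R x y → Seg R y xs z → Seg R x (y ∷ xs) z

infixr 5 _◂_ _◂◂_

_◂◂_ : ∀ {A R} {x y z : A} {xs ys} → Seg R x xs y → Seg R y ys z → Seg R x (xs ++ ys) z
end     ◂◂ t = t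
(r ◂ s) ◂◂ t = r ◂ (s ◂◂ t)

Seg-map : ∀ {A B : Set} {R R′} (f : A → B) → (∀ {x y} → R x y → R′ (f x) (f y)) →
          ∀ {x xs y} → Seg R x xs y → Seg R′ (f x) (map f xs) (f y)
Seg-map f r end     = end
Seg-map f r (p ◂ s) = r p ◂ Seg-map f r s

same-index : ∀ {A : Set} {P Q : A → Set} {xs} (i : Any P xs) (j : Any Q xs) →
             toℕ (index i) ≡ toℕ (index j) → ∃ λ x → x ∈ xs × P x × Q x
same-index (here p)  (here q)  _  = _ , here refl , p , q
same-index (there i) (there j) eq
  with x , x∈xs , p , q ← same-index i j (ℕ-suc-injective eq) = x , there x∈xs , p , q

next-index : ∀ {A : Set} {R} {P Q : A → Set} {x xs y} → Seg R x xs y →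
             (i : Any P (x ∷ xs)) (j : Any Q (x ∷ xs)) →
             toℕ (index j) ≡ suc (toℕ (index i)) → ∃₂ λ u v → R u v × P u × Q v
next-index (r ◂ s) (here p)  (there (here q)) _  = _ , _ , r , p , q
next-index (r ◂ s) (there i) (there j)        eq = next-index s i j (ℕ-suc-injective eq)

2≤∣m-n∣ : ∀ m n → m ≢ n → n ≢ suc m → m ≢ suc n → 2 ≤ ∣ m - n ∣
2≤∣m-n∣ zero          zero          m≢n _ _ = contradiction refl m≢n
2≤∣m-n∣ zero          (suc zero)    _ n≢ _  = contradiction refl n≢
2≤∣m-n∣ zero          (suc (suc n)) _ _ _   = s≤s (s≤s z≤n)
2≤∣m-n∣ (suc zero)    zero          _ _ m≢  = contradiction refl m≢
2≤∣m-n∣ (suc (suc m)) zero          _ _ _   = s≤s (s≤s z≤n)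
2≤∣m-n∣ (suc m)       (suc n)       a b c   =
  2≤∣m-n∣ m n (a ∘ cong suc) (b ∘ cong suc) (c ∘ cong suc)

module _ {V : Set} (G : Graph V) where

  Apart : List V → List V → Set
  Apart C D = All (λ x → All (λ y → adj G x y ≡ false) D) C

  Independent : List V → Set
  Independent C = ∀ {x y} → x ∈ C → y ∈ C → x ≢ y → ¬ Near G x y

  -- A vertex gets the position of the class that `cover` finds for it. Equal labels mean a common
  -- independent class, consecutive labels mean consecutive classes, which are apart. Positions
  -- start at 0, hence the bound `length L`.
  labelling : ∀ {C L D} → Seg Apart C L D → All Independent (C ∷ L) → (∀ x → Any (x ∈_) (C ∷ L)) →
              Σ (V → ℕ) λ f → IsL21 G f × (∀ x → f x ≤ length L)
  labelling seg ind cover = f , (λ x y → d1 x y , d2 x y) , λ x → s≤s⁻¹ (toℕ<n (index (cover x)))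
    where
    f = λ x → toℕ (index (cover x))

    same : ∀ {x y} → f x ≡ f y → x ≢ y → ¬ Near G x y
    same {x} {y} eq with C , C∈ , x∈C , y∈C ← same-index (cover x) (cover y) eq =
      All.lookup ind C∈ x∈C y∈C

    next : ∀ {x y} → f y ≡ suc (f x) → adj G x y ≡ false
    next {x} {y} eq with _ , _ , apart , x∈ , y∈ ← next-index seg (cover x) (cover y) eq =
      All.lookup (All.lookup apart x∈) y∈

    d1 : ∀ x y → Dist G x y 1 → 2 ≤ ∣ f x - f y ∣
    d1 x y (step xy here , _) = 2≤∣m-n∣ (f x) (f y)
      (λ eq → same eq (λ { refl → true≢false xy (irrefl G x) }) (inj₁ xy))
      (λ eq → true≢false xy (next eq))
      (λ eq → true≢false xy (adj-sym G (next eq)))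

    d2 : ∀ x y → Dist G x y 2 → f x ≢ f y
    d2 x y (step xc (step cy here) , shortest) eq =
      same eq (λ { refl → shortest 0 z<s here }) (inj₂ (_ , xc , cy))

-- Pigeonhole for distinct labels

Unique-map-local : ∀ {A B : Set} (f : A → B) {xs} → (∀ {x y} → x ∈ xs → y ∈ xs → x ≢ y → f x ≢ f y) →
                   Unique xs → Unique (map f xs)
Unique-map-local f inj []          = []
Unique-map-local f inj (x≢ ∷ xs!) =
  Allₚ.map⁺ (All.tabulate λ y∈ → inj (here refl) (there y∈) (All.lookup x≢ y∈)) ∷
  Unique-map-local f (λ x∈ y∈ → inj (there x∈) (there y∈)) xs!

module _ {m : ℕ} where

  toFins : ∀ {l} → All (_< m) l → List (Fin m)
  toFins = All.reduce λ x<m → fromℕ< x<m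

  length-toFins : ∀ {l} (l<m : All (_< m) l) → length (toFins l<m) ≡ length l
  length-toFins []        = refl
  length-toFins (_ ∷ l<m) = cong suc (length-toFins l<m)

  toFins-≢ : ∀ {x l} (x<m : x < m) → All (x ≢_) l → (l<m : All (_< m) l) →
             All (fromℕ< x<m ≢_) (toFins l<m)
  toFins-≢ x<m []        []          = []
  toFins-≢ x<m (x≢ ∷ ne) (y<m ∷ l<m) =
    (λ eq → x≢ (fromℕ<-injective _ _ x<m y<m eq)) ∷ toFins-≢ x<m ne l<m

  Unique-toFins : ∀ {l} → Unique l → (l<m : All (_< m) l) → Unique (toFins l<m)
  Unique-toFins []        []          = []
  Unique-toFins (ne ∷ l!) (x<m ∷ l<m) = toFins-≢ x<m ne l<m ∷ Unique-toFins l! l<m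

  Unique-bounded : ∀ {l} → Unique l → All (_< m) l → length l ≤ m
  Unique-bounded l! l<m = subst (_ ≤_) (∣⊤∣≡n m)
    (subst (_≤ _) (length-toFins l<m) (length≤∣p∣ (Unique-toFins l! l<m) (All.tabulate λ _ → ∈⊤)))

-- A missing `j` could be put in front, giving `m + 1` distinct numbers below `m`.
Unique-full : ∀ {m} {l : List ℕ} → Unique l → All (_< m) l → length l ≡ m → ∀ {j} → j < m → j ∈ l
Unique-full {l = l} l! l<m len {j} j<m with j ∈ℕ? l
... | yes j∈l = j∈l
... | no  j∉l = contradiction (subst (λ k → suc k ≤ _) len
                  (Unique-bounded (Allₚ.¬Any⇒All¬ l j∉l ∷ l!) (j<m ∷ l<m))) 1+n≰n

-- Iterated Mycielskians and the lower bound

-- The i-th bit, read from the outermost Mycielskian inwards, says whether the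
-- vertex is the new copy at that level.
vert : ∀ {V s} → V → Vec Bool s → MVⁿ s V
vert v []          = v
vert v (false ∷ w) = old (vert v w)
vert v (true  ∷ w) = new (vert v w)

copies : ∀ {A} → List A → List (MV A)
copies []       = []
copies (x ∷ xs) = old x ∷ new x ∷ copies xs

hubs : ∀ V s → List (MVⁿ s V)
hubs V zero    = []
hubs V (suc s) = hub ∷ copies (hubs V s)

vertices : ∀ {V} → List V → ∀ s → List (MVⁿ s V)
vertices vs zero    = vs
vertices vs (suc s) = hub ∷ copies (vertices vs s)

module _ {A : Set} where

  ∈-copies-old⁺ : ∀ {x : A} {xs} → x ∈ xs → old x ∈ copies xs
  ∈-copies-old⁺ (here refl) = here refl
  ∈-copies-old⁺ (there x∈)  = there (there (∈-copies-old⁺ x∈))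

  ∈-copies-new⁺ : ∀ {x : A} {xs} → x ∈ xs → new x ∈ copies xs
  ∈-copies-new⁺ (here refl) = there (here refl)
  ∈-copies-new⁺ (there x∈)  = there (there (∈-copies-new⁺ x∈))

  ∈-copies⁻ : ∀ {y : MV A} {xs} → y ∈ copies xs → ∃ λ x → x ∈ xs × (y ≡ old x ⊎ y ≡ new x)
  ∈-copies⁻ {xs = x ∷ xs} (here refl)         = x , here refl , inj₁ refl
  ∈-copies⁻ {xs = x ∷ xs} (there (here refl)) = x , here refl , inj₂ refl
  ∈-copies⁻ {xs = x ∷ xs} (there (there y∈)) with z , z∈ , eq ← ∈-copies⁻ y∈ = z , there z∈ , eq

  Unique-hub∷copies : ∀ {xs : List A} → Unique xs → Unique (hub ∷ copies xs)
  Unique-hub∷copies xs! = hub≢ ∷ go xs!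
    where
    hub≢ : ∀ {xs} → All (hub ≢_) (copies {A} xs)
    hub≢ = All.tabulate λ y∈ eq → case-copies y∈ eq
      where
      case-copies : ∀ {y xs} → y ∈ copies {A} xs → hub ≢ y
      case-copies y∈ refl with ∈-copies⁻ y∈
      ... | _ , _ , inj₁ ()
      ... | _ , _ , inj₂ ()

    old≢ : ∀ {x xs} → All (x ≢_) xs → All (old x ≢_) (copies xs)
    old≢ []         = []
    old≢ (ne ∷ nes) = (λ { refl → ne refl }) ∷ (λ ()) ∷ old≢ nes

    new≢ : ∀ {x xs} → All (x ≢_) xs → All (new x ≢_) (copies xs)
    new≢ []         = []
    new≢ (ne ∷ nes) = (λ ()) ∷ (λ { refl → ne refl }) ∷ new≢ nes

    go : ∀ {xs} → Unique xs → Unique (copies xs)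
    go []         = []
    go (ne ∷ xs!) = ((λ ()) ∷ old≢ ne) ∷ new≢ ne ∷ go xs!

  length-copies : ∀ (xs : List A) → length (copies xs) ≡ 2 * length xs
  length-copies []       = refl
  length-copies (x ∷ xs) = trans (cong (2 +_) (length-copies xs)) (lemma (length xs))
    where
    lemma : ∀ m → 2 + 2 * m ≡ 2 * suc m
    lemma = solve-∀

Unique-hubs : ∀ V s → Unique (hubs V s)
Unique-hubs V zero    = []
Unique-hubs V (suc s) = Unique-hub∷copies (Unique-hubs V s)

Unique-vertices : ∀ {V} {vs : List V} → Unique vs → ∀ s → Unique (vertices vs s)
Unique-vertices vs! zero    = vs!
Unique-vertices vs! (suc s) = Unique-hub∷copies (Unique-vertices vs! s)

length-double : ∀ {m s k} → suc m ≡ 2 ^ s * k → suc (suc (2 * m)) ≡ 2 ^ suc s * k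
length-double {m} {s} {k} eq = begin
  suc (suc (2 * m)) ≡⟨ lemma m ⟩
  2 * suc m         ≡⟨ cong (2 *_) eq ⟩
  2 * (2 ^ s * k)   ≡⟨ ≡-sym (*-assoc 2 (2 ^ s) k) ⟩
  2 ^ suc s * k     ∎
  where
  open ≡-Reasoning
  lemma : ∀ m → suc (suc (2 * m)) ≡ 2 * suc m
  lemma = solve-∀

length-hubs : ∀ V s → suc (length (hubs V s)) ≡ 2 ^ s * 1
length-hubs V zero    = refl
length-hubs V (suc s) rewrite length-copies (hubs V s) = length-double {s = s} (length-hubs V s)

length-vertices : ∀ {V} (vs : List V) s → suc (length (vertices vs s)) ≡ 2 ^ s * suc (length vs)
length-vertices vs zero    = ≡-sym (+-identityʳ _)
length-vertices vs (suc s) rewrite length-copies (vertices vs s) = length-double {s = s} (length-vertices vs s)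

hub-or-vert : ∀ {V} s (x : MVⁿ s V) → x ∈ hubs V s ⊎ ∃₂ λ v (w : Vec Bool s) → x ≡ vert v w
hub-or-vert zero    v   = inj₂ (v , [] , refl)
hub-or-vert (suc s) hub = inj₁ (here refl)
hub-or-vert (suc s) (old x) with hub-or-vert s x
... | inj₁ x∈             = inj₁ (there (∈-copies-old⁺ x∈))
... | inj₂ (v , w , refl) = inj₂ (v , false ∷ w , refl)
hub-or-vert (suc s) (new x) with hub-or-vert s x
... | inj₁ x∈             = inj₁ (there (∈-copies-new⁺ x∈))
... | inj₂ (v , w , refl) = inj₂ (v , true ∷ w , refl)

vert∉hubs : ∀ {V s} v (w : Vec Bool s) → vert v w ∉ hubs V s
vert∉hubs v (false ∷ w) (there x∈) with ∈-copies⁻ x∈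
... | _ , z∈ , inj₁ refl = vert∉hubs v w z∈
vert∉hubs v (true ∷ w) (there x∈) with ∈-copies⁻ x∈
... | _ , z∈ , inj₂ refl = vert∉hubs v w z∈

vert-injective : ∀ {V s} {u v : V} (w : Vec Bool s) → vert u w ≡ vert v w → u ≡ v
vert-injective []          eq = eq
vert-injective (false ∷ w) eq = vert-injective w (old-injective eq)
  where
  old-injective : ∀ {A} {x y : A} → old x ≡ old y → x ≡ y
  old-injective refl = refl
vert-injective (true ∷ w) eq = vert-injective w (new-injective eq)
  where
  new-injective : ∀ {A} {x y : A} → new x ≡ new y → x ≡ y
  new-injective refl = refl

module _ {V : Set} {G : Graph V} where

  Near-old-old : ∀ {x y} → Near G x y → Near (M G) (old x) (old y)
  Near-old-old (inj₁ xy)            = inj₁ xy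
  Near-old-old (inj₂ (c , xc , cy)) = inj₂ (old c , xc , cy)

  Near-old-new : ∀ {x y} → Near G x y → Near (M G) (old x) (new y)
  Near-old-new (inj₁ xy)            = inj₁ xy
  Near-old-new (inj₂ (c , xc , cy)) = inj₂ (old c , xc , cy)

  Near-new-old : ∀ {x y} → Near G x y → Near (M G) (new x) (old y)
  Near-new-old (inj₁ xy)            = inj₁ xy
  Near-new-old (inj₂ (c , xc , cy)) = inj₂ (old c , xc , cy)

  Near-new-new : ∀ {x y} → Near (M G) (new x) (new y)
  Near-new-new = inj₂ (hub , refl , refl)

  Near-hub : V → NoIsolated G → ∀ y → Near (M G) hub y
  Near-hub v₀ ni hub     = inj₂ (new v₀ , refl , refl)
  Near-hub v₀ ni (new y) = inj₁ refl
  Near-hub v₀ ni (old y) with c , yc ← ni y = inj₂ (new c , refl , adj-sym G yc)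

  NoIsolated-M : V → NoIsolated G → NoIsolated (M G)
  NoIsolated-M v₀ ni (old x) with c , xc ← ni x = old c , xc
  NoIsolated-M v₀ ni (new x) = hub , refl
  NoIsolated-M v₀ ni hub     = new v₀ , refl

  Near-refl : NoIsolated G → ∀ x → Near G x x
  Near-refl ni x with c , xc ← ni x = inj₂ (c , xc , adj-sym G xc)

module _ {V : Set} (s : ℕ) where

  -- The vertices that are pairwise near. Of the inner hubs only the old copies are added, because
  -- their new copies already occur in `map new (vertices vs s)`.
  core : List V → List (MVⁿ (suc s) V)
  core vs = hub ∷ map new (vertices vs s) ++ map old (hubs V s)

  Unique-core : ∀ {vs} → Unique vs → Unique (core vs)
  Unique-core {vs} vs! =
    All.tabulate (λ y∈ eq → hub∉ (subst (_∈ _) (≡-sym eq) y∈)) ∷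
    Unique-++⁺ (Unique-map⁺ (λ { refl → refl }) (Unique-vertices vs! s))
               (Unique-map⁺ (λ { refl → refl }) (Unique-hubs V s)) disjoint
    where
    hub∉ : hub ∉ map new (vertices vs s) ++ map old (hubs V s)
    hub∉ h∈ with ∈-++⁻ (map new (vertices vs s)) h∈
    ... | inj₁ h∈₁ with _ , _ , () ← ∈-map⁻ new h∈₁
    ... | inj₂ h∈₂ with _ , _ , () ← ∈-map⁻ old h∈₂
    disjoint : ∀ {x} → ¬ (x ∈ map new (vertices vs s) × x ∈ map old (hubs V s))
    disjoint (x∈₁ , x∈₂) with _ , _ , refl ← ∈-map⁻ new x∈₁ with _ , _ , () ← ∈-map⁻ old x∈₂

  length-core : ∀ vs → suc (length (core vs)) ≡ 2 ^ s * (length vs + 2)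
  length-core vs = begin
    suc (suc (length (map new (vertices vs s) ++ map old (hubs V s))))
      ≡⟨ cong (2 +_) (length-++ (map new (vertices vs s))) ⟩
    2 + (length (map new (vertices vs s)) + length (map old (hubs V s)))
      ≡⟨ cong (2 +_) (cong₂ _+_ (length-map new (vertices vs s)) (length-map old (hubs V s))) ⟩
    2 + (length (vertices vs s) + length (hubs V s))
      ≡⟨ cong suc (≡-sym (+-suc _ _)) ⟩
    suc (length (vertices vs s)) + suc (length (hubs V s))
      ≡⟨ cong₂ _+_ (length-vertices vs s) (length-hubs V s) ⟩
    2 ^ s * suc (length vs) + 2 ^ s * 1
      ≡⟨ lemma (2 ^ s) (length vs) ⟩
    2 ^ s * (length vs + 2) ∎
    where
    open ≡-Reasoning
    lemma : ∀ a b → a * suc b + a * 1 ≡ a * (b + 2)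
    lemma = solve-∀

module _ {V : Set} {G : Graph V} where

  -- At the outermost level where `w` has `true`, both vertices are new copies and share a hub; if
  -- there is none, nearness in `G` lifts through all levels.
  Near-verts : ∀ {s u v} (w : Vec Bool s) → Near G u v → Near (Mᵗ s G) (vert u w) (vert v (replicate s true))
  Near-verts []          uv = uv
  Near-verts (false ∷ w) uv = Near-old-new (Near-verts w uv)
  Near-verts (true  ∷ w) uv = Near-new-new

  -- A single `true` in `w` suffices for a shared hub, so only the all-`false` word can escape.
  meets-top : ∀ {s} u v (w : Vec Bool s) → w ≡ replicate s false ⊎ Near (Mᵗ s G) (vert u w) (vert v (replicate s true))
  meets-top u v []          = inj₁ refl
  meets-top u v (true  ∷ w) = inj₂ Near-new-new
  meets-top u v (false ∷ w) with meets-top u v w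
  ... | inj₁ refl = inj₁ refl
  ... | inj₂ near = inj₂ (Near-old-new near)

module _ {V : Set} {G : Graph V} (v₀ : V) (ni : NoIsolated G) where

  NoIsolated-Mᵗ : ∀ s → NoIsolated (Mᵗ s G)
  NoIsolated-Mᵗ zero    = ni
  NoIsolated-Mᵗ (suc s) = NoIsolated-M (vert v₀ (replicate s false)) (NoIsolated-Mᵗ s)

  -- The outermost hub reaches every old copy through a new one because no vertex is isolated.
  -- Copies of inner hubs inherit nearness by induction, and two new copies share the outermost hub.
  Near-hubs : ∀ s {h} → h ∈ hubs V s → ∀ x → Near (Mᵗ s G) h x
  Near-hubs (suc s) (here refl) x = Near-hub (vert v₀ (replicate s false)) (NoIsolated-Mᵗ s) x
  Near-hubs (suc s) (there h∈)  x with ∈-copies⁻ h∈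
  Near-hubs (suc s) (there h∈) (old x) | _ , z∈ , inj₁ refl = Near-old-old (Near-hubs s z∈ x)
  Near-hubs (suc s) (there h∈) (new x) | _ , z∈ , inj₁ refl = Near-old-new (Near-hubs s z∈ x)
  Near-hubs (suc s) (there h∈) hub     | z , z∈ , inj₁ refl =
    Near-sym (Mᵗ (suc s) G) {hub} {old z} (Near-hub z (NoIsolated-Mᵗ s) (old z))
  Near-hubs (suc s) (there h∈) (old x) | _ , z∈ , inj₂ refl = Near-new-old (Near-hubs s z∈ x)
  Near-hubs (suc s) (there h∈) (new x) | _ , z∈ , inj₂ refl = Near-new-new
  Near-hubs (suc s) (there h∈) hub     | _ , z∈ , inj₂ refl = inj₁ refl

  Near-core : ∀ s {vs x y} → x ∈ core s vs → y ∈ core s vs → Near (Mᵗ (suc s) G) x y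
  Near-core s {vs} {x} {y} x∈ y∈ = go x y (kind x∈) (kind y∈)
    where
    data Kind : MVⁿ (suc s) V → Set where
      isHub : ∀ {x} → x ∈ hubs V (suc s) → Kind x
      isNew : ∀ {x} → Kind (new x)

    kind : ∀ {x} → x ∈ core s vs → Kind x
    kind (here refl) = isHub (here refl)
    kind (there x∈) with ∈-++⁻ (map new (vertices vs s)) x∈
    ... | inj₁ x∈₁ with _ , _ , refl ← ∈-map⁻ new x∈₁ = isNew
    ... | inj₂ x∈₂ with _ , h∈ , refl ← ∈-map⁻ old x∈₂ = isHub (there (∈-copies-old⁺ h∈))

    go : ∀ x y → Kind x → Kind y → Near (Mᵗ (suc s) G) x y
    go x y (isHub h∈) _          = Near-hubs (suc s) h∈ y
    go x y isNew      (isHub h∈) = Near-sym (Mᵗ (suc s) G) {y} {x} (Near-hubs (suc s) h∈ x)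
    go x y isNew      isNew      = Near-new-new

  Unique-labels : ∀ s {vs f} → Unique vs → IsL21 (Mᵗ (suc s) G) f → Unique (map f (core s vs))
  Unique-labels s vs! L21 = Unique-map-local _
    (λ x∈ y∈ → L21⇒≢ (Mᵗ (suc s) G) L21 (Near-core s x∈ y∈)) (Unique-core s vs!)

span : ℕ → ℕ → ℕ
span n s = 2 ^ s * (n + 2) ∸ 2

length-core-allFin : ∀ n s → length (core s (allFin n)) ≡ suc (span n s)
length-core-allFin n s = lemma
  (trans (length-core s (allFin n)) (cong (λ m → 2 ^ s * (m + 2)) (length-tabulate {n = n} (λ i → i))))
  -- The truncated subtraction in `span` is exact, since `2 ^ s * (n + 2)` is at least 2.
  (≤-trans (m≤n+m 2 n) (m≤n*m (n + 2) (2 ^ s) {{m^n≢0 2 s}}))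
  where
  lemma : ∀ {m N} → suc m ≡ N → 2 ≤ N → m ≡ suc (N ∸ 2)
  lemma refl (s≤s (s≤s z≤n)) = refl

module _ {n : ℕ} {G : Graph (Fin n)} (v₀ : Fin n) (ni : NoIsolated G) (s : ℕ) where

  -- The core carries `span n s + 1` distinct labels, which cannot all lie below `span n s`.
  lower-bound : ∀ f → IsL21 (Mᵗ (suc s) G) f → ∃ λ x → span n s ≤ f x
  lower-bound f L21 with All.all? (λ x → suc (f x) ≤? span n s) (core s (allFin n))
  ... | yes small = contradiction
        (subst (_≤ span n s) (trans (length-map f (core s (allFin n))) (length-core-allFin n s))
          (Unique-bounded (Unique-labels v₀ ni s (allFin⁺ n) L21) (Allₚ.map⁺ small))) 1+n≰n
  ... | no ¬small with x , _ , fx≥ ← find (Allₚ.¬All⇒Any¬ (λ x → suc (f x) ≤? span n s) _ ¬small) = x , ≮⇒≥ fx≥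

-- Necessity: far pairs from an optimal labelling

module _ {n : ℕ} {G : Graph (Fin n)} (v₀ : Fin n) (ni : NoIsolated G) (r : ℕ) where
  private
    s = suc r
    H = Mᵗ (suc s) G

  -- The core has as many vertices as there are labels, so it uses all of them, also the one of the
  -- old copy of `v` with all inner bits `true`. The core vertex with that label is not a hub, and
  -- by `meets-top` it is a new copy with all inner bits `false`.
  partner : ∀ f → IsL21 H f → (∀ x → f x ≤ span n s) → ∀ v →
            ∃ λ v′ → f (vert v′ (true ∷ replicate s false)) ≡ f (vert v (false ∷ replicate s true)) × Far G v v′
  partner f L21 bound v
    with c , c∈ , fx≡fc ← ∈-map⁻ f (Unique-full (Unique-labels v₀ ni s (allFin⁺ n) L21)
           (Allₚ.map⁺ (All.tabulate λ {x} _ → s≤s (bound x)))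
           (trans (length-map f (core s (allFin n))) (length-core-allFin n s))
           (s≤s (bound (vert v (false ∷ replicate s true)))))
    = go c fx≡fc c∈
    where
    x : MVⁿ (suc s) (Fin n)
    x = vert v (false ∷ replicate s true)

    not-near : ∀ {c} → f x ≡ f c → x ≢ c → ¬ Near H c x
    not-near {c} eq x≢c near = L21⇒≢ H L21 near (x≢c ∘ ≡-sym) (≡-sym eq)

    not-hub : ∀ {c} → f x ≡ f c → c ∉ hubs (Fin n) (suc s)
    not-hub {c} eq c∈ = not-near {c} eq (λ { refl → vert∉hubs v (false ∷ replicate s true) c∈ })
                          (Near-hubs v₀ ni (suc s) c∈ x)

    go : ∀ c → f x ≡ f c → c ∈ core s (allFin n) →
         ∃ λ v′ → f (vert v′ (true ∷ replicate s false)) ≡ f x × Far G v v′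
    go hub eq _ = contradiction (here refl) (not-hub eq)
    go (old h) eq (there c∈) with ∈-++⁻ (map new (vertices (allFin n) s)) c∈
    ... | inj₁ c∈₁ with _ , _ , () ← ∈-map⁻ new c∈₁
    ... | inj₂ c∈₂ with _ , h∈ , refl ← ∈-map⁻ old c∈₂ = contradiction (there (∈-copies-old⁺ h∈)) (not-hub eq)
    go (new z) eq _ with hub-or-vert s z
    ... | inj₁ z∈ = contradiction (there (∈-copies-new⁺ z∈)) (not-hub eq)
    ... | inj₂ (v′ , w , refl) with meets-top {G = G} v′ v w
    ...   | inj₂ near = contradiction (Near-new-old near) (not-near eq λ ())
    -- `v′` differs from `v`, because a vertex that is not isolated is near itself.
    ...   | inj₁ refl = v′ , ≡-sym eq , (λ { refl → not-near-G (Near-refl {G = G} ni v) }) , not-near-G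
      where
      not-near-G : ¬ Near G v v′
      not-near-G near = not-near eq (λ ())
        (Near-new-old (Near-verts {G = G} (replicate s false) (Near-sym G near)))

  far-injection : ∀ f → IsL21 H f → (∀ x → f x ≤ span n s) →
                  ∃ λ (π : Fin n → Fin n) → (∀ {x y} → π x ≡ π y → x ≡ y) × (∀ v → Far G v (π v))
  far-injection f L21 bound = choose (partner f L21 bound)
    where
    choose : (∀ v → ∃ λ v′ → f (vert v′ (true ∷ replicate s false)) ≡ f (vert v (false ∷ replicate s true)) × Far G v v′) →
             ∃ λ (π : Fin n → Fin n) → (∀ {x y} → π x ≡ π y → x ≡ y) × (∀ v → Far G v (π v))
    choose p = proj₁ ∘ p , inj , (λ v → proj₂ (proj₂ (p v)))
      where
      inj : ∀ {x y} → proj₁ (p x) ≡ proj₁ (p y) → x ≡ y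
      inj {x} {y} eq with x Fin.≟ y
      ... | yes same = same
      ... | no  x≢y  = contradiction
            (trans (≡-sym (proj₁ (proj₂ (p x))))
              (trans (cong (λ v → f (vert v (true ∷ replicate s false))) eq) (proj₁ (proj₂ (p y)))))
            -- Here `t ≥ 2` enters: both words have `true` at the second level, so the two vertices
            -- have a copy of that level's hub as common neighbour and cannot share a label.
            (L21⇒≢ H L21 (Near-old-old Near-new-new) λ e → x≢y (vert-injective (false ∷ replicate s true) e))

-- Edges and odd cycles of the far graph

module _ {V : Set} (G : Graph V) where

  Far⇒nonadj : ∀ {a b} → Far G a b → adj G a b ≡ false
  Far⇒nonadj (_ , ¬near) = ¬-not (¬near ∘ inj₁)

  Far⇒no-common : ∀ {a b c} → Far G a b → adj G a c ≡ true → adj G b c ≡ false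
  Far⇒no-common (_ , ¬near) ac = ¬-not λ bc → ¬near (inj₂ (_ , ac , adj-sym G bc))

  -- The list holds the inner vertices only, so that `FarPath a l a` is a closed walk visiting
  -- `a ∷ l`.
  FarPath : V → List V → V → Set
  FarPath a []      b = Far G a b
  FarPath a (x ∷ l) b = Far G a x × FarPath x l b

  FarPath-++⁺ : ∀ {a} l {x l′ b} → FarPath a l x → FarPath x l′ b → FarPath a (l ++ x ∷ l′) b
  FarPath-++⁺ []      ax        xb = ax , xb
  FarPath-++⁺ (y ∷ l) (ay , yx) xb = ay , FarPath-++⁺ l yx xb

  FarPath-++⁻ : ∀ {a} l {x l′ b} → FarPath a (l ++ x ∷ l′) b → FarPath a l x × FarPath x l′ b
  FarPath-++⁻ []      (ax , xb) = ax , xb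
  FarPath-++⁻ (y ∷ l) (ay , yb) with yx , xb ← FarPath-++⁻ l yb = (ay , yx) , xb

  data Even : List V → Set where
    none : Even []
    pair : ∀ x y {l} → Even l → Even (x ∷ y ∷ l)

  -- An edge or an odd cycle of the far graph; the cycle is start ∷ rest, so that
  -- an even rest makes it odd.
  record Block : Set where
    constructor block
    field
      start : V
      rest  : List V
      cycle : FarPath start rest start
      shape : Even rest ⊎ ∃ λ b → rest ≡ [ b ]

    support : List V
    support = start ∷ rest

  open Block public

  supports : List Block → List V
  supports = concatMap support

  Even? : ∀ l → Even l ⊎ ∃₂ λ x l′ → l ≡ x ∷ l′ × Even l′
  Even? []      = inj₁ none
  Even? (x ∷ l) with Even? l
  ... | inj₁ even                   = inj₂ (x , l , refl , even)
  ... | inj₂ (y , l′ , refl , even) = inj₁ (pair x y even)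

  -- Takes every second edge of the path as a block; the last edge, to `b`, is among those left out.
  edges : ∀ {a x l b} → Even l → FarPath a (x ∷ l) b → ∃ λ bs → supports bs ≡ a ∷ x ∷ l
  edges {a} {x} none            (ax , _)            =
    block a [ x ] (ax , Far-sym G ax) (inj₂ (x , refl)) ∷ [] , refl
  edges {a} {x} (pair y z even) (ax , _ , yz) with bs , eq ← edges even yz =
    block a [ x ] (ax , Far-sym G ax) (inj₂ (x , refl)) ∷ bs , cong (λ l → a ∷ x ∷ l) eq

  cycle-blocks : ∀ {a} l → FarPath a l a → ∃ λ bs → supports bs ≡ a ∷ l
  cycle-blocks {a} l cyc with Even? l
  ... | inj₁ even                   = block a l cyc (inj₁ even) ∷ [] , cong (a ∷_) (++-identityʳ l)
  ... | inj₂ (x , l′ , refl , even) = edges even cyc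

  -- The neighbours of p and of q would have to alternate along an odd cycle.
  alternate : ∀ {p q} → ∀ {z l b} → Even l → FarPath z l b → adj G z p ≡ true →
              (∃ λ y → y ∈ z ∷ l × adj G y p ≡ false × adj G y q ≡ false) ⊎ adj G b p ≡ false
  alternate none zb zp = inj₂ (Far⇒no-common zb zp)
  alternate {p} {q} (pair x y even) (zx , xy , yb) zp with adj G x q in xq
  ... | false = inj₁ (x , there (here refl) , Far⇒no-common zx zp , xq)
  -- As `x` is adjacent to `q`, its far neighbour `y` is not. So `y` serves unless it is adjacent to
  -- `p`, which is the situation of `z` again.
  ... | true with adj G y p in yp
  ...   | false = inj₁ (y , there (there (here refl)) , yp , Far⇒no-common xy xq)
  ...   | true with alternate {p} {q} even yb yp
  ...     | inj₁ (u , u∈ , good) = inj₁ (u , there (there u∈) , good)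
  ...     | inj₂ bp              = inj₂ bp

  odd-entry : ∀ p q {z l} → Even l → FarPath z l z →
              ∃ λ y → y ∈ z ∷ l × adj G y p ≡ false × adj G y q ≡ false
  odd-entry p q {z} even cyc with adj G z p in zp | adj G z q in zq
  ... | false | false = z , here refl , zp , zq
  ... | true  | _ with alternate {p} {q} even cyc zp
  ...   | inj₁ found = found
  -- The path ends where it began, so the second alternative of `alternate` speaks about `z` itself.
  ...   | inj₂ ¬zp   = true≢false zp ¬zp
  odd-entry p q {z} even cyc | false | true with alternate {q} {p} even cyc zq
  ...   | inj₁ (y , y∈ , yq , yp) = y , y∈ , yp , yq
  ...   | inj₂ ¬zq                = true≢false zq ¬zq

  rotate : ∀ {z l y} → FarPath z l z → y ∈ z ∷ l → ∃ λ l′ → FarPath y l′ y ×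
           (∀ {v} → v ∈ z ∷ l → v ∈ y ∷ l′) × length l′ ≡ length l
  rotate {l = l} cyc (here refl) = l , cyc , (λ v∈ → v∈) , refl
  rotate {z} {y = y} cyc (there y∈) with xs , ys , refl ← ∈-∃++ y∈
    with zy , yz ← FarPath-++⁻ xs cyc = ys ++ z ∷ xs , FarPath-++⁺ ys yz zy , mem , len
    where
    mem : ∀ {v} → v ∈ z ∷ xs ++ y ∷ ys → v ∈ y ∷ ys ++ z ∷ xs
    mem (here refl) = there (∈-++⁺ʳ ys (here refl))
    mem (there v∈) with ∈-++⁻ xs v∈
    ... | inj₁ v∈xs         = there (∈-++⁺ʳ ys (there v∈xs))
    ... | inj₂ (here refl)  = here refl
    ... | inj₂ (there v∈ys) = there (∈-++⁺ˡ v∈ys)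

    len : length (ys ++ z ∷ xs) ≡ length (xs ++ y ∷ ys)
    len rewrite length-++ ys {z ∷ xs} | length-++ xs {y ∷ ys} | +-suc (length ys) (length xs)
      | +-suc (length xs) (length ys) = cong suc (+-comm (length ys) (length xs))

-- Cutting a far permutation into blocks

module _ {n : ℕ} (G : Graph (Fin n)) (π : Fin n → Fin n)
         (π-inj : ∀ {x y} → π x ≡ π y → x ≡ y) (π-far : ∀ x → Far G x (π x)) where

  private
    without : Fin n → List (Fin n) → List (Fin n)
    without z = filter λ y → ¬? (y Fin.≟ z)

    ∈-without⁺ : ∀ {z y Q} → y ∈ Q → y ≢ z → y ∈ without z Q
    ∈-without⁺ {z} = ∈-filter⁺ λ y → ¬? (y Fin.≟ z)

    ∈-without⁻ : ∀ {z y} Q → y ∈ without z Q → y ∈ Q × y ≢ z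
    ∈-without⁻ {z} Q = ∈-filter⁻ (λ y → ¬? (y Fin.≟ z)) {xs = Q}

    length-without : ∀ {z Q} → z ∈ Q → length (without z Q) < length Q
    length-without {z} {Q} z∈ = filter-notAll (λ y → ¬? (y Fin.≟ z)) Q (Any.map (λ { refl ¬p → ¬p refl }) z∈)

    keep : ∀ {x y Q} → y ∈ Q → y ∈ x ∷ without x Q
    keep {x} {y} y∈ with y Fin.≟ x
    ... | yes y≡x = here y≡x
    ... | no  y≢x = there (∈-without⁺ y∈ y≢x)

    closed-without : ∀ {x y z Q} → y ≢ z → π y ∈ x ∷ Q → π y ∈ x ∷ without (π z) Q
    closed-without _   (here eq)  = here eq
    closed-without y≢z (there y∈) = there (∈-without⁺ y∈ (y≢z ∘ π-inj))

    uncons : ∀ {v x : Fin n} {Q} → v ∈ x ∷ Q → v ≡ x ⊎ v ∈ Q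
    uncons (here eq)  = inj₁ eq
    uncons (there v∈) = inj₂ v∈

  -- Splits off one orbit of `π` at a time; `fuel` bounds `Q` to ensure termination. Disjointness of
  -- the blocks is expressed by counting: they cover `Q` and their total length does not exceed that
  -- of `Q`.
  decompose : ∀ fuel Q → length Q ≤ fuel → (∀ {y} → y ∈ Q → π y ∈ Q) →
              ∃ λ bs → (∀ {v} → v ∈ Q → v ∈ supports G bs) × length (supports G bs) ≤ length Q

  -- Follow π from x: z ∷ l is the orbit so far, latest vertex first, and Q holds
  -- the vertices not yet visited.
  walk : ∀ fuel x z l Q → length Q ≤ fuel → (∀ y → Far G x y → FarPath G z l y) →
         z ∉ Q → π z ∈ x ∷ Q → (∀ {y} → y ∈ Q → π y ∈ x ∷ Q) →
         ∃ λ bs → (∀ {v} → v ∈ (z ∷ l) ++ Q → v ∈ supports G bs) ×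
                  length (supports G bs) ≤ length (z ∷ l) + length Q

  decompose fuel       []        len closed = [] , (λ ()) , z≤n
  decompose (suc fuel) Q@(x ∷ _) len closed
    with bs , mem , size ← walk fuel x x [] (without x Q) (s≤s⁻¹ (≤-trans (length-without {x} {Q} (here refl)) len))
           (λ _ xy → xy) (λ x∈ → proj₂ (∈-without⁻ Q x∈) refl) (keep (closed (here refl)))
           (λ y∈ → keep (closed (proj₁ (∈-without⁻ Q y∈))))
    = bs , mem ∘ keep , ≤-trans size (length-without {x} {Q} (here refl))

  walk zero x z l [] _ path z∉Q (there ()) closed
  walk (suc fuel) x z l Q len path z∉Q (there πz∈Q) closed
    with bs , mem , size ← walk fuel x (π z) (z ∷ l) (without (π z) Q) (s≤s⁻¹ (≤-trans (length-without πz∈Q) len))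
           (λ y xy → Far-sym G (π-far z) , path y xy) (λ ∈Q′ → proj₂ (∈-without⁻ Q ∈Q′) refl)
           (closed-without (λ eq → proj₁ (π-far z) (≡-sym eq)) (closed πz∈Q))
           (λ y∈ → let y∈Q = proj₁ (∈-without⁻ Q y∈) in closed-without (λ { refl → z∉Q y∈Q }) (closed y∈Q))
    = bs , mem ∘ move , ≤-trans size (s≤s (≤-trans (≤-reflexive (≡-sym (+-suc (length l) (length (without (π z) Q)))))
        (+-monoʳ-≤ (length l) (length-without πz∈Q))))
    where
    move : ∀ {v} → v ∈ (z ∷ l) ++ Q → v ∈ (π z ∷ z ∷ l) ++ without (π z) Q
    move v∈ with ∈-++⁻ (z ∷ l) v∈
    ... | inj₁ v∈l = there (∈-++⁺ˡ v∈l)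
    ... | inj₂ v∈Q with keep v∈Q
    ...   | here v≡πz  = here v≡πz
    ...   | there v∈Q′ = there (∈-++⁺ʳ (z ∷ l) v∈Q′)
  walk fuel x z l Q len path z∉Q (here πz≡x) closed
    -- `path` may end in any vertex far from `x`; since `x` is `π z`, it may end in `z`, which
    -- closes the cycle.
    with bs₁ , eq₁ ← cycle-blocks G l (path z (subst (λ u → Far G u z) πz≡x (Far-sym G (π-far z))))
    -- By injectivity only `z` is mapped to `x`, so the unvisited `Q` is closed under `π`.
    with bs₂ , mem , size ← decompose fuel Q len (λ y∈Q →
           [ (λ πy≡x → contradiction (π-inj (trans πy≡x (≡-sym πz≡x))) λ { refl → z∉Q y∈Q }) , (λ p → p) ]′
             (uncons (closed y∈Q)))
    = bs₁ ++ bs₂ ,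
      (λ v∈ → subst (_ ∈_) (≡-sym eq) ([ ∈-++⁺ˡ , ∈-++⁺ʳ (z ∷ l) ∘ mem ]′ (∈-++⁻ (z ∷ l) v∈))) ,
      subst (_≤ _) (≡-sym (trans (cong length eq) (length-++ (z ∷ l)))) (+-monoʳ-≤ (length (z ∷ l)) size)
    where
    eq : supports G (bs₁ ++ bs₂) ≡ (z ∷ l) ++ supports G bs₂
    eq = trans (concatMap-++ support bs₁ bs₂) (cong (_++ supports G bs₂) eq₁)

  far-decomposition : ∃ λ bs → (∀ v → v ∈ supports G bs) × length (supports G bs) ≤ n
  far-decomposition
    with bs , mem , size ← decompose (length (allFin n)) (allFin n) ≤-refl (λ {y} _ → ∈-allFin (π y))
    = bs , (λ v → mem (∈-allFin v)) , ≤-trans size (≤-reflexive (length-tabulate {n = n} (λ i → i)))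

-- Sequences of label classes

swap : ∀ {A : Set} {a b v : A} → v ∈ a ∷ b ∷ [] → v ∈ b ∷ a ∷ []
swap (here refl)         = there (here refl)
swap (there (here refl)) = here refl

-- Only the two ends of the enumeration matter, whence the relation `⊤`: classes of a fixed pair are
-- apart for any two words. Covering all words with length `2 ^ s` leaves no room for repetition.
words : ∀ b s → ∃ λ W → Seg (λ _ _ → ⊤) (replicate s b) W (replicate s (not b)) ×
        (∀ w → w ∈ replicate s b ∷ W) × suc (length W) ≡ 2 ^ s
words b zero = [] , end , (λ { [] → here refl }) , refl
words b (suc s) with W , seg , mem , len ← words b s =
  map (b ∷_) W ++ map (not b ∷_) (replicate s b ∷ W) ,
  Seg-map (b ∷_) _ seg ◂◂ tt ◂ Seg-map (not b ∷_) _ seg ,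
  both , length-eq
  where
  both : ∀ w → w ∈ map (b ∷_) (replicate s b ∷ W) ++ map (not b ∷_) (replicate s b ∷ W)
  both (x ∷ w) with x Bool.≟ b
  ... | yes refl = ∈-++⁺ˡ (∈-map⁺ (x ∷_) (mem w))
  ... | no  x≢b rewrite ¬-not x≢b = ∈-++⁺ʳ (map (b ∷_) (replicate s b ∷ W)) (∈-map⁺ (not b ∷_) (mem w))

  length-eq : length (map (b ∷_) (replicate s b ∷ W) ++ map (not b ∷_) (replicate s b ∷ W)) ≡ 2 ^ suc s
  length-eq = trans (length-++ (map (b ∷_) (replicate s b ∷ W)))
    (cong₂ _+_ (trans (length-map _ (replicate s b ∷ W)) len)
               (trans (trans (length-map _ (replicate s b ∷ W)) len) (≡-sym (+-identityʳ (2 ^ s)))))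

∁∁ : ∀ {s} (w : Vec Bool s) → ∁ (∁ w) ≡ w
∁∁ []      = refl
∁∁ (b ∷ w) = cong₂ _∷_ (not-involutive b) (∁∁ w)

-- Every edge between copies projects to an edge of `G`.
vert-nonadj : ∀ {V} (G : Graph V) {s a b} (w w′ : Vec Bool s) → adj G a b ≡ false →
              adj (Mᵗ s G) (vert a w) (vert b w′) ≡ false
vert-nonadj G []          []           ab = ab
vert-nonadj G (false ∷ w) (false ∷ w′) ab = vert-nonadj G w w′ ab
vert-nonadj G (false ∷ w) (true  ∷ w′) ab = vert-nonadj G w w′ ab
vert-nonadj G (true  ∷ w) (false ∷ w′) ab = vert-nonadj G w w′ ab
vert-nonadj G (true  ∷ w) (true  ∷ w′) ab = refl

module _ {V : Set} {G : Graph V} where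

  Near-old-new⁻ : ∀ {x y} → Near (M G) (old x) (new y) → Near G x y
  Near-old-new⁻ (inj₁ xy)                = inj₁ xy
  Near-old-new⁻ (inj₂ (old c , xc , cy)) = inj₂ (c , xc , cy)

  Near-new-old⁻ : ∀ {x y} → Near (M G) (new x) (old y) → Near G x y
  Near-new-old⁻ (inj₁ xy)                = inj₁ xy
  Near-new-old⁻ (inj₂ (old c , xc , cy)) = inj₂ (c , xc , cy)

module _ {V : Set} {G : Graph V} where

  -- Complementary words are never both new at a level. So no hub is a common neighbour, and a
  -- common neighbour must be an old copy at each level and projects to `G`.
  Near-vert-∁⁻ : ∀ {s a b} (w : Vec Bool s) → Near (Mᵗ s G) (vert a w) (vert b (∁ w)) → Near G a b
  Near-vert-∁⁻ []          near = near
  Near-vert-∁⁻ (false ∷ w) near = Near-vert-∁⁻ w (Near-old-new⁻ near)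
  Near-vert-∁⁻ (true  ∷ w) near = Near-vert-∁⁻ w (Near-new-old⁻ near)

-- The last entry of `hubs V (suc s)`: the innermost hub, replaced by its new copy at every later
-- level.
lastHub : ∀ {V} s → MVⁿ (suc s) V
lastHub zero    = hub
lastHub (suc s) = new (lastHub s)

module _ {V : Set} (G : Graph V) where

  NonAdj : V → V → Set
  NonAdj x y = adj G x y ≡ false

  -- Each step from `x` to `y` becomes `new x`, `old y`, `new y`; the second move is allowed because
  -- `y` is not adjacent to itself.
  Seg-copies : ∀ {x xs y} → Seg NonAdj x xs y → Seg (λ u v → adj (M G) u v ≡ false) (new x) (copies xs) (new y)
  Seg-copies end = end
  Seg-copies (_◂_ {y = y} xy seg) = xy ◂ irrefl G y ◂ Seg-copies seg

module _ {V : Set} (G : Graph V) where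

  Seg-hubs : ∀ s → Seg (NonAdj (Mᵗ (suc s) G)) hub (copies (hubs V s)) (lastHub s)
  Seg-hubs zero    = end
  Seg-hubs (suc s) = refl ◂ refl ◂ Seg-copies (Mᵗ (suc s) G) (Seg-hubs s)

  lastHub-nonadj : ∀ s a → NonAdj (Mᵗ (suc s) G) (lastHub s) (vert a (replicate (suc s) false))
  lastHub-nonadj zero    a = refl
  lastHub-nonadj (suc s) a = lastHub-nonadj s a

-- Touring the blocks by label classes

module _ {V : Set} (G : Graph V) (r : ℕ) where
  private
    s = suc r
    H = Mᵗ (suc s) G
    Class = List (MVⁿ (suc s) V)
    ∅ full : Vec Bool s
    ∅    = replicate s false
    full = replicate s true

  -- The outermost bits are fixed: as `w` runs through all words, the classes use up the outermost
  -- old copies of `a` and the outermost new copies of `b`.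
  P : V → V → Vec Bool s → Class
  P a b w = vert a (false ∷ w) ∷ vert b (true ∷ ∁ w) ∷ []

  P-independent : ∀ {a b} w → Far G a b → Independent H (P a b w)
  P-independent w (_ , ¬near) (here refl)         (here refl)         x≢y _    = x≢y refl
  P-independent w (_ , ¬near) (here refl)         (there (here refl)) _   near = ¬near (Near-vert-∁⁻ w (Near-old-new⁻ near))
  P-independent {a} {b} w (_ , ¬near) (there (here refl)) (here refl) _   near =
    ¬near (Near-vert-∁⁻ w (Near-old-new⁻ (Near-sym H {vert b (true ∷ ∁ w)} {vert a (false ∷ w)} near)))
  P-independent w (_ , ¬near) (there (here refl)) (there (here refl)) x≢y _    = x≢y refl

  P-same : ∀ {a b} → Far G a b → ∀ w w′ → Apart H (P a b w) (P a b w′)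
  P-same {a} {b} ab w w′ =
    (vert-nonadj G w w′ (irrefl G a) ∷ vert-nonadj G w (∁ w′) (Far⇒nonadj G ab) ∷ []) ∷
    (vert-nonadj G (∁ w) w′ (adj-sym G (Far⇒nonadj G ab)) ∷ refl ∷ []) ∷ []

  P-swap : ∀ {a b} → Far G a b → ∀ w w′ → Apart H (P a b w) (P b a w′)
  P-swap {a} {b} ab w w′ =
    (vert-nonadj G w w′ (Far⇒nonadj G ab) ∷ vert-nonadj G w (∁ w′) (irrefl G a) ∷ []) ∷
    (vert-nonadj G (∁ w) w′ (irrefl G b) ∷ refl ∷ []) ∷ []

  -- The copy of `b` is new at every level, that of `p` at the second and that of `q` at the
  -- outermost. Hence `b` is unconstrained and only adjacency to `a` counts.
  P-full-∅ : ∀ {p q a b} → adj G p a ≡ false → adj G q a ≡ false → Apart H (P p q full) (P a b ∅)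
  P-full-∅ pa qa =
    (vert-nonadj G full ∅ pa ∷ refl ∷ []) ∷ (vert-nonadj G (∁ full) ∅ qa ∷ refl ∷ []) ∷ []

  P-full-full : ∀ {p q a b} → adj G p b ≡ false → adj G q a ≡ false → Apart H (P p q full) (P a b full)
  P-full-full pb qa =
    (refl ∷ vert-nonadj G full (∁ full) pb ∷ []) ∷ (vert-nonadj G (∁ full) full qa ∷ refl ∷ []) ∷ []

  -- On a part of a cycle, ss is fs shifted by one vertex.
  record Tour (C : Class) (fs ss : List V) (D : Class) : Set where
    field
      classes     : List Class
      seg         : Seg (Apart H) C classes D
      olds        : ∀ {v} → v ∈ fs → ∀ w → ∃ λ b → P v b w ∈ classes
      news        : ∀ {v} → v ∈ ss → ∀ w → ∃ λ a → P a v w ∈ classes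
      independent : All (Independent H) classes
      size        : length classes ≡ length fs * 2 ^ s
  open Tour

  _⋈_ : ∀ {C D E fs ss fs′ ss′} → Tour C fs ss D → Tour D fs′ ss′ E → Tour C (fs ++ fs′) (ss ++ ss′) E
  _⋈_ {fs = fs} {ss} {fs′} S T = record
    { classes     = classes S ++ classes T
    ; seg         = seg S ◂◂ seg T
    ; olds        = λ v∈ w → [ (λ v∈₁ → let b , P∈ = olds S v∈₁ w in b , ∈-++⁺ˡ P∈)
                             , (λ v∈₂ → let b , P∈ = olds T v∈₂ w in b , ∈-++⁺ʳ (classes S) P∈) ]′ (∈-++⁻ fs v∈)
    ; news        = λ v∈ w → [ (λ v∈₁ → let a , P∈ = news S v∈₁ w in a , ∈-++⁺ˡ P∈)
                             , (λ v∈₂ → let a , P∈ = news T v∈₂ w in a , ∈-++⁺ʳ (classes S) P∈) ]′ (∈-++⁻ ss v∈)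
    ; independent = Allₚ.++⁺ (independent S) (independent T)
    ; size        = begin
        length (classes S ++ classes T)             ≡⟨ length-++ (classes S) ⟩
        length (classes S) + length (classes T)     ≡⟨ cong₂ _+_ (size S) (size T) ⟩
        length fs * 2 ^ s + length fs′ * 2 ^ s      ≡⟨ *-distribʳ-+ (2 ^ s) (length fs) (length fs′) ⟨
        (length fs + length fs′) * 2 ^ s            ≡⟨ cong (_* 2 ^ s) (length-++ fs) ⟨
        length (fs ++ fs′) * 2 ^ s                  ∎
    }
    where open ≡-Reasoning

  restrict : ∀ {C D fs ss vs} → (∀ {v} → v ∈ vs → v ∈ fs) → (∀ {v} → v ∈ vs → v ∈ ss) →
             length fs ≡ length vs → Tour C fs ss D → Tour C vs vs D
  restrict ⊆fs ⊆ss len T = record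
    { classes = classes T ; seg = seg T ; olds = olds T ∘ ⊆fs ; news = news T ∘ ⊆ss
    ; independent = independent T ; size = trans (size T) (cong (_* 2 ^ s) len) }

  run : ∀ {C a b} x → Far G a b → Apart H C (P a b (replicate s x)) →
        Tour C [ a ] [ b ] (P a b (replicate s (not x)))
  run {C} {a} {b} x ab entry with W , sg , mem , len ← words x s = record
    { classes     = map (P a b) (replicate s x ∷ W)
    ; seg         = entry ◂ Seg-map (P a b) (λ {w} {w′} _ → P-same ab w w′) sg
    ; olds        = λ { (here refl) w → b , ∈-map⁺ (P a b) (mem w) }
    ; news        = λ { (here refl) w → a , ∈-map⁺ (P a b) (mem w) }
    ; independent = Allₚ.map⁺ (All.tabulate λ {w} _ → P-independent w ab)
    ; size        = trans (length-map (P a b) (replicate s x ∷ W)) (trans len (≡-sym (+-identityʳ _)))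
    }

  -- Runs from `∅` to `full` for each pair of consecutive vertices. The next pair starts with `x`,
  -- which is adjacent neither to `a` nor to itself, so `P-full-∅` applies. `entry` allows any `b`,
  -- since the second vertex depends on `l`.
  tour-path : ∀ {C a e} l → FarPath G a l e → (∀ b → Apart H C (P a b ∅)) →
              ∃ λ z → Far G z e × Tour C (a ∷ l) (l ++ [ e ]) (P z e full)
  tour-path {a = a} []      ae        entry = a , ae , run false ae (entry _)
  tour-path {a = a} (x ∷ l) (ax , xe) entry
    with z , ze , T ← tour-path {C = P a x full} l xe (λ b → P-full-∅ (Far⇒nonadj G ax) (irrefl G x)) =
    z , ze , run false ax (entry x) ⋈ T

  Exit : Class → List V → Set
  Exit C vs = ∃₂ λ p q → Far G p q × Tour C vs vs (P p q full)

  -- On a closed path the shifted list `l ++ [ a ]` has the same members as `a ∷ l`. The list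
  -- `x ∷ xs` keeps the block's own order when the tour starts at another of its vertices.
  tour-cycle : ∀ {C a x xs} l → FarPath G a l a → (∀ b → Apart H C (P a b ∅)) →
               (∀ {v} → v ∈ x ∷ xs → v ∈ a ∷ l) → length l ≡ length xs → Exit C (x ∷ xs)
  tour-cycle {a = a} l cyc entry vs⊆ len with z , za , T ← tour-path l cyc entry =
    z , a , za , restrict vs⊆ (swing ∘ vs⊆) (cong suc len) T
    where
    swing : ∀ {v} → v ∈ a ∷ l → v ∈ l ++ [ a ]
    swing (here refl) = ∈-++⁺ʳ l (here refl)
    swing (there v∈)  = ∈-++⁺ˡ v∈

  enter-from-hub : ∀ {C} → (∀ a b → Apart H C (P a b ∅)) → ∀ B → Exit C (support B)
  enter-from-hub entry B = tour-cycle (rest B) (cycle B) (entry (start B)) (λ v∈ → v∈) refl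

  -- Descends from `full` to `∅` with `a` first, changes over by `P-swap`, and ascends with `b`
  -- first, so that it exits at `full` as well. Entry at `full` is chosen because an edge need not
  -- have an end nonadjacent to both vertices of the previous pair.
  tour-edge : ∀ {C a b vs} → Far G a b → Apart H C (P a b full) →
              (∀ {v} → v ∈ vs → v ∈ a ∷ b ∷ []) → length vs ≡ 2 → Exit C vs
  tour-edge {C} {a} {b} ab entry vs⊆ len = b , a , Far-sym G ab ,
    restrict vs⊆ (swap ∘ vs⊆) (≡-sym len)
      (run true ab entry ⋈ run false (Far-sym G ab) (P-swap ab ∅ ∅))

  -- An odd cycle is rotated to start at a vertex adjacent to neither `p` nor `q`. For an edge, one
  -- of the two orientations fits: if `p` is adjacent to `b`, then `p` is not adjacent to `a` and
  -- `q` not to `b`; similarly if `q` is adjacent to `a`.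
  enter-from-P : ∀ {p q} → Far G p q → ∀ B → Exit (P p q full) (support B)
  enter-from-P {p} {q} pq (block a l cyc (inj₁ even))
    with y , y∈ , yp , yq ← odd-entry G p q even cyc
    with l′ , cyc′ , mem , len ← rotate G cyc y∈ =
    tour-cycle l′ cyc′ (λ b → P-full-∅ (adj-sym G yp) (adj-sym G yq)) mem len
  enter-from-P {p} {q} pq (block a _ (ab , _) (inj₂ (b , refl))) with adj G p b in pb | adj G q a in qa
  ... | false | false = tour-edge ab (P-full-full pb qa) (λ v∈ → v∈) refl
  ... | true  | _     = tour-edge (Far-sym G ab) (P-full-full (adj-sym G (Far⇒no-common G (Far-sym G ab) (adj-sym G pb)))
                          (Far⇒no-common G pq pb)) swap refl
  ... | false | true  = tour-edge (Far-sym G ab) (P-full-full (Far⇒no-common G (Far-sym G pq) qa)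
                          (adj-sym G (Far⇒no-common G ab (adj-sym G qa)))) swap refl

  tour-blocks : ∀ {C} → (∀ B → Exit C (support B)) → ∀ bs → ∃ λ D → Tour C (supports G bs) (supports G bs) D
  tour-blocks {C} enter []       = C , record
    { classes = [] ; seg = end ; olds = λ () ; news = λ () ; independent = [] ; size = refl }
  tour-blocks     enter (B ∷ bs) with p , q , pq , T ← enter B
    with D , T′ ← tour-blocks (enter-from-P pq) bs = D , T ⋈ T′

  hub-classes : List Class
  hub-classes = map [_] (copies (hubs V s))

  Seg-hub-classes : Seg (Apart H) [ hub ] hub-classes [ lastHub s ]
  Seg-hub-classes = Seg-map [_] (λ xy → (xy ∷ []) ∷ []) (Seg-hubs G s)

  hub-classes-independent : All (Independent H) ([ hub ] ∷ hub-classes)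
  hub-classes-independent = Allₚ.map⁺ {xs = hubs V (suc s)}
    (All.tabulate λ { _ (here refl) (here refl) x≢x _ → x≢x refl })

  covers : ∀ {C D fs ss} → (∀ v → v ∈ fs) → (∀ v → v ∈ ss) → (T : Tour C fs ss D) →
           ∀ x → Any (x ∈_) (([ hub ] ∷ hub-classes) ++ classes T)
  covers fs∋ ss∋ T x with hub-or-vert (suc s) x
  ... | inj₁ x∈ = lose (∈-++⁺ˡ (∈-map⁺ [_] x∈)) (here refl)
  ... | inj₂ (v , false ∷ w , refl) with b , P∈ ← olds T (fs∋ v) w =
        lose (∈-++⁺ʳ ([ hub ] ∷ hub-classes) P∈) (here refl)
  -- In second position a class holds the complement of its word, so `w` is found at `∁ w`.
  ... | inj₂ (v , true ∷ w , refl) with a , P∈ ← news T (ss∋ v) (∁ w) =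
        lose (∈-++⁺ʳ ([ hub ] ∷ hub-classes) P∈) (there (here (cong (λ w → vert v (true ∷ w)) (≡-sym (∁∁ w)))))

  size-classes : ∀ {C D fs ss} (T : Tour C fs ss D) →
                 length (hub-classes ++ classes T) ≡ 2 ^ s * (length fs + 2) ∸ 2
  size-classes {fs = fs} T = begin
    length (hub-classes ++ classes T)             ≡⟨ length-++ hub-classes ⟩
    length hub-classes + length (classes T)       ≡⟨ cong₂ _+_ (trans (length-map [_] (copies (hubs V s))) (length-copies (hubs V s))) (size T) ⟩
    -- Adding and subtracting 2 turns `h` into `suc h`, the form known from `length-hubs`. The class
    -- `[ hub ]`, which has label 0, is not counted.
    2 * h + length fs * 2 ^ s                     ≡⟨ cong (_∸ 2) (lemma₁ h (length fs * 2 ^ s)) ⟩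
    2 * suc h + length fs * 2 ^ s ∸ 2             ≡⟨ cong (λ m → 2 * m + length fs * 2 ^ s ∸ 2) (length-hubs V s) ⟩
    2 * (2 ^ s * 1) + length fs * 2 ^ s ∸ 2       ≡⟨ cong (_∸ 2) (lemma₂ (2 ^ s) (length fs)) ⟩
    2 ^ s * (length fs + 2) ∸ 2                   ∎
    where
    open ≡-Reasoning
    h = length (hubs V s)
    lemma₁ : ∀ a b → 2 + (2 * a + b) ≡ 2 * suc a + b
    lemma₁ = solve-∀
    lemma₂ : ∀ a b → 2 * (a * 1) + b * a ≡ a * (b + 2)
    lemma₂ = solve-∀

  block-labelling : ∀ bs → (∀ v → v ∈ supports G bs) →
    Σ (MVⁿ (suc s) V → ℕ) λ f → IsL21 H f × (∀ x → f x ≤ 2 ^ s * (length (supports G bs) + 2) ∸ 2)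
  block-labelling bs all
    -- `lastHub s` is a new copy, so it is not adjacent to the new copy of `b`; `lastHub-nonadj`
    -- deals with `a`.
    with D , T ← tour-blocks (enter-from-hub λ a b → (lastHub-nonadj G r a ∷ refl ∷ []) ∷ []) bs
    with f , L21 , bound ← labelling H (Seg-hub-classes ◂◂ seg T)
           (Allₚ.++⁺ hub-classes-independent (independent T)) (covers all all T)
    = f , L21 , λ x → ≤-trans (bound x) (≤-reflexive (size-classes T))

-- The relation behind `D₂` and the equivalence

module _ {n : ℕ} (G : Graph (Fin n)) where

  -- The arguments are exchanged so that `nbhd farᵇ S` is definitionally `D₂ G S`, which makes the
  -- condition of the theorem literally `Hall farᵇ`.
  farᵇ : Fin n → Fin n → Bool
  farᵇ v x = not (within2 G x v)

  farᵇ⇒Far : ∀ v x → farᵇ v x ≡ true → Far G x v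
  farᵇ⇒Far v x eq with x Fin.≟ v | adj G x v in xv
  ... | no x≢v | false = x≢v , λ where
    (inj₁ ())
    (inj₂ (c , xc , cv)) → true≢false
      (any-true⁺ (λ w → adj G x w ∧ adj G w v) (∈-allFin c) (cong₂ _∧_ xc cv))
      (trans (≡-sym (not-involutive _)) (cong not eq))

  Far⇒farᵇ : ∀ v x → Far G x v → farᵇ v x ≡ true
  Far⇒farᵇ v x (x≢v , ¬near) with x Fin.≟ v | adj G x v
  ... | yes x≡v | _     = contradiction x≡v x≢v
  ... | no _    | true  = contradiction (inj₁ refl) ¬near
  ... | no _    | false = cong not (¬-not λ eq →
        let c , xcv = any-true⁻ (λ w → adj G x w ∧ adj G w v) (allFin n) eq
        in ¬near (inj₂ (c , ∧-true⁻ (adj G x c) xcv)))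

theorem4p6 : (n : ℕ) → 2 ≤ n → (G : Graph (Fin n)) → NoIsolated G →
    (t : ℕ) → 2 ≤ t →
    IsLambda (Mᵗ t G) (2 ^ (t ∸ 1) * (n + 2) ∸ 2)
    ⇔ (∀ (S : Subset n) → ∣ S ∣ ≤ ∣ D₂ G S ∣)
theorem4p6 n@(suc _) _ G ni (suc zero) (s≤s ())
theorem4p6 n@(suc _) _ G ni (suc (suc r)) _ = mk⇔ necessary sufficient
  where
  s = suc r

  necessary : IsLambda (Mᵗ (suc s) G) (span n s) → ∀ S → ∣ S ∣ ≤ ∣ D₂ G S ∣
  necessary ((f , L21 , bound) , _) S = count (far-injection zero ni r f L21 bound)
    where
    count : ∃ (λ (π : Fin n → Fin n) → (∀ {x y} → π x ≡ π y → x ≡ y) × (∀ v → Far G v (π v))) → ∣ S ∣ ≤ ∣ D₂ G S ∣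
    count (π , inj , far) = injection⇒∣p∣≤∣q∣ {p = S} π inj λ {v} v∈S →
      ∈-nbhd⁺ (farᵇ G) v∈S (Far⇒farᵇ G v (π v) (Far-sym G (far v)))

  sufficient : (∀ S → ∣ S ∣ ≤ ∣ D₂ G S ∣) → IsLambda (Mᵗ (suc s) G) (span n s)
  sufficient hall = upper (hall-theorem (farᵇ G) hall) , lower-bound zero ni s
    where
    relabel : ∃ (λ bs → (∀ v → v ∈ supports G bs) × length (supports G bs) ≤ n) →
              Σ (MVⁿ (suc s) (Fin n) → ℕ) λ f → IsL21 (Mᵗ (suc s) G) f × (∀ x → f x ≤ span n s)
    relabel (bs , all , size) = map₂ (map₂ λ bound x →
      ≤-trans (bound x) (∸-monoˡ-≤ 2 (*-monoʳ-≤ (2 ^ s) (+-monoˡ-≤ 2 size)))) (block-labelling G r bs all)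

    upper : ∃ (λ (π : Fin n → Fin n) → (∀ {x y} → π x ≡ π y → x ≡ y) × (∀ v → farᵇ G v (π v) ≡ true)) →
            Σ (MVⁿ (suc s) (Fin n) → ℕ) λ f → IsL21 (Mᵗ (suc s) G) f × (∀ x → f x ≤ span n s)
    upper (π , inj , far) = relabel (far-decomposition G π inj λ v → Far-sym G (farᵇ⇒Far G v (π v) (far v)))
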